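{- For any integers $k \ge \ell \ge 3$, there exists a graph $G$ such that $G \nrightarrow (K_k,K_{\ell})$ and $G \rightarrow (K_{s},K_{\ell-1})$ for $s\leq R(k,\ell)-1$.
   Context: For a graph $G$ and positive integers $a,b$, $G \rightarrow (K_a,K_b)$ means every red-blue colouring of the edges of $G$ contains a red copy of $K_a$ or a blue copy of $K_b$; $G\nrightarrow (K_a,K_b)$ is its negation. $R(k,\ell)$ is the minimum $n$ such that $K_n\rightarrow (K_k,K_\ell)$. -}

module Defs where

open import Data.Nat using (ℕ; _<_)
open import Data.Fin using (Fin)
open import Data.Product using (Σ; _×_)
open import Data.Sum using (_⊎_)
open import Relation.Binary.PropositionalEquality using (_≡_; _≢_; refl)
  renaming (sym to ≡-sym)
open import Relation.Nullary using (¬_)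

record Graph : Set₁ where
  field
    n    : ℕ
    Adj  : Fin n → Fin n → Set
    sym  : ∀ {u v} → Adj u v → Adj v u
    irr  : ∀ {u} → ¬ Adj u u
open Graph public

K : ℕ → Graph
K m = record { n = m ; Adj = λ u v → u ≢ v ; sym = λ p q → p (≡-sym q) ; irr = λ p → p refl }

data Colour : Set where
  red blue : Colour

record Colouring (G : Graph) : Set where
  field
    col     : (u v : Fin (n G)) → Adj G u v → Colour
    col-sym : ∀ {u v} (e : Adj G u v) → col v u (sym G e) ≡ col u v e
open Colouring public

MonoClique : (G : Graph) → Colouring G → Colour → ℕ → Set
MonoClique G χ c a =
  Σ (Fin a → Fin (n G)) λ f →
    (∀ i j → f i ≡ f j → i ≡ j) ×
    ((i j : Fin a) → (i≢j : i ≢ j) →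
       Σ (Adj G (f i) (f j)) λ e → col χ (f i) (f j) e ≡ c)

_⟶[_,_] : Graph → ℕ → ℕ → Set
G ⟶[ a , b ] = (χ : Colouring G) → MonoClique G χ red a ⊎ MonoClique G χ blue b

IsRamseyNumber : ℕ → ℕ → ℕ → Set
IsRamseyNumber k ℓ r = (K r ⟶[ k , ℓ ]) × (∀ m → m < r → ¬ (K m ⟶[ k , ℓ ]))

{-# OPTIONS --safe #-}
module Submission where

-- Put N = R(k,ℓ) − 1 and fix a colouring χ₀ of K_N with no red K_k and no blue K_ℓ.  Adding a vertex
-- joined to everything in blue (in red) and using K_{N+1} → (K_k,K_ℓ) shows that χ₀ contains a blue
-- (a red) K_{ℓ-1}.  The Nešetřil–Rödl partite construction, driven by the Hales–Jewett theorem and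
-- started from many disjoint copies of χ₀, yields a graph G with a fixed colouring free of red K_k and
-- blue K_ℓ, such that for every colouring χ of G some copy of χ₀ has χ(e) = γ(χ₀(e)) for a function
-- γ : {red, blue} → {red, blue}.  If γ is constantly red, this copy is a red K_N; otherwise γ sends
-- blue or red to blue, and the blue or red K_{ℓ-1} of χ₀ becomes a blue K_{ℓ-1} of χ.

open import Defs using (Graph; Adj; irr; K; Colour; red; blue; Colouring; MonoClique; _⟶[_,_]; IsRamseyNumber)
open import Data.Nat using (ℕ; zero; suc; _+_; _*_; _∸_; _≤_; _<_; z≤n; s≤s; s≤s⁻¹; _≤?_)
import Data.Nat.Properties as ℕₚ
open import Data.Fin as Fin using (Fin; zero; suc)
import Data.Fin.Properties as Finₚ
open import Data.List as List using (List; []; _∷_; length; filter)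
import Data.List.Properties as Listₚ
open import Data.List.Membership.Propositional using (_∈_; lose)
open import Data.List.Membership.Propositional.Properties using (∈-++⁺ˡ; ∈-++⁺ʳ; ∈-allFin; ∈-cartesianProduct⁺; ∈-cartesianProductWith⁺; ∈-filter⁺; ∈-lookup; ∈-map⁺)
open import Data.List.Relation.Binary.Sublist.Propositional using (_⊆_; []; _∷_; _∷ʳ_; ⊆-trans; minimum)
open import Data.List.Relation.Binary.Sublist.Propositional.Properties using (All-resp-⊆; filter-⊆)
open import Data.List.Relation.Unary.All as All using (All; []; _∷_)
import Data.List.Relation.Unary.All.Properties as Allₚ
open import Data.List.Relation.Unary.AllPairs using (AllPairs; []; _∷_)
open import Data.List.Relation.Unary.Any as Any using (here; there; index)
open import Data.List.Relation.Unary.Any.Properties using (lookup-index)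
import Data.List.Relation.Unary.Unique.Propositional.Properties as Uniqueₚ
open import Data.Maybe as Maybe using (Maybe; just; nothing; maybe′; Is-just; to-witness; fromMaybe)
import Data.Maybe.Properties as Maybeₚ
open import Data.Maybe.Relation.Unary.Any using (just)
open import Data.Product using (Σ; ∃; _×_; _,_; proj₁; proj₂)
open import Data.Sum using (_⊎_; inj₁; inj₂)
open import Data.Unit using (tt)
open import Data.Vec using (Vec; []; _∷_; _++_; map; lookup; tabulate; _[_]≔_)
import Data.Vec.Properties as Vecₚ
import Data.Vec.Relation.Unary.Any as VAny
import Data.Vec.Relation.Unary.Any.Properties as VAnyₚ
open import Function using (_∘_; id; case_of_)
open import Level using (0ℓ)
open import Relation.Binary using (Rel; DecidableEquality; tri<; tri≈; tri>)
open import Relation.Binary.PropositionalEquality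
open import Relation.Nullary using (¬_; Dec; yes; no; contradiction; map′; ¬?; _×-dec_; _→-dec_)
open import Relation.Unary using (Pred; Decidable)

-- Finite types given by enumerations

record Finite (X : Set) : Set where
  field
    elems    : List X
    complete : ∀ x → x ∈ elems

  card : ℕ
  card = length elems

  position : X → Fin card
  position x = index (complete x)

  lookup-position : ∀ x → x ≡ List.lookup elems (position x)
  lookup-position x = lookup-index (complete x)

  position-injective : ∀ {x y} → position x ≡ position y → x ≡ y
  position-injective {x} {y} eq = trans (lookup-position x)
    (trans (cong (List.lookup elems) eq) (sym (lookup-position y)))

  _≟_ : DecidableEquality X
  x ≟ y = map′ position-injective (cong position) (position x Finₚ.≟ position y)

  any? : {P : Pred X 0ℓ} → Decidable P → Dec (∃ P)
  any? P? = map′ Any.satisfied (λ (x , px) → lose (complete x) px) (Any.any? P? elems)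

open Finite using (elems; complete; card; position; lookup-position)

module _ {X Y : Set} where

  ×-finite : Finite X → Finite Y → Finite (X × Y)
  ×-finite F G .elems = List.cartesianProduct (elems F) (elems G)
  ×-finite F G .complete (x , y) = ∈-cartesianProduct⁺ (complete F x) (complete G y)

Fin-finite : ∀ n → Finite (Fin n)
Fin-finite n .elems = List.allFin n
Fin-finite n .complete = ∈-allFin

Maybe-finite : ∀ {X} → Finite X → Finite (Maybe X)
Maybe-finite F .elems = nothing ∷ List.map just (elems F)
Maybe-finite F .complete nothing  = here refl
Maybe-finite F .complete (just x) = there (∈-map⁺ just (complete F x))

Vec-finite : ∀ {X} → Finite X → ∀ n → Finite (Vec X n)
Vec-finite F zero    .elems       = [] ∷ []
Vec-finite F zero    .complete [] = here refl
Vec-finite F (suc n) .elems = List.cartesianProductWith _∷_ (elems F) (elems (Vec-finite F n))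
Vec-finite F (suc n) .complete (x ∷ xs) =
  ∈-cartesianProductWith⁺ _∷_ (complete F x) (complete (Vec-finite F n) xs)

module _ {X : Set} {R : Rel X 0ℓ} where

  AllPairs-lookup : ∀ {xs} → AllPairs R xs → ∀ {i j} → i Fin.< j →
    R (List.lookup xs i) (List.lookup xs j)
  AllPairs-lookup (r ∷ _)  {zero}  {suc j} _         = All.lookup r (∈-lookup j)
  AllPairs-lookup (_ ∷ rs) {suc i} {suc j} (s≤s i<j) = AllPairs-lookup rs i<j

distinct⇒length≤card : ∀ {X} (F : Finite X) {xs} → AllPairs _≢_ xs → length xs ≤ card F
distinct⇒length≤card F {xs} ps = Finₚ.injective⇒≤ {f = position F ∘ List.lookup xs} inj
  where
  inj : ∀ {i j} → position F (List.lookup xs i) ≡ position F (List.lookup xs j) → i ≡ j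
  inj {i} {j} eq with Finₚ.<-cmp i j
  ... | tri< i<j _ _ = contradiction (Finite.position-injective F eq) (AllPairs-lookup ps i<j)
  ... | tri≈ _ i≡j _ = i≡j
  ... | tri> _ _ j<i = contradiction (sym (Finite.position-injective F eq)) (AllPairs-lookup ps j<i)

-- The Hales–Jewett theorem

-- A word with holes; a combinatorial line is a template with at least one hole.
Template : Set → ℕ → Set
Template A n = Vec (Maybe A) n

HasHole : ∀ {A n} → Template A n → Set
HasHole = VAny.Any (_≡ nothing)

-- Letters and filling value may differ in type: `s` is `id` or `suc` in the Hales-Jewett proof, and
-- later sends an edge, used as a letter, to one of its endpoints.
fill : ∀ {A B : Set} {n} → (A → B) → Template A n → B → Vec B n
fill s T b = map (maybe′ s b) T

module _ {A B : Set} where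

  map-fill : ∀ {n} (s : A → B) (T : Template A n) a → map s (fill id T a) ≡ fill s T (s a)
  map-fill s []             a = refl
  map-fill s (nothing ∷ T) a = cong (s a ∷_) (map-fill s T a)
  map-fill s (just x ∷ T)  a = cong (s x ∷_) (map-fill s T a)

  fill-map : ∀ {n} (s : A → B) (T : Template A n) b → fill id (map (Maybe.map s) T) b ≡ fill s T b
  fill-map s []             b = refl
  fill-map s (nothing ∷ T) b = cong (b ∷_) (fill-map s T b)
  fill-map s (just x ∷ T)  b = cong (s x ∷_) (fill-map s T b)

  hole-map : ∀ {n} {s : A → B} {T : Template A n} → HasHole T → HasHole (map (Maybe.map s) T)
  hole-map (VAny.here refl) = VAny.here refl
  hole-map (VAny.there h)   = VAny.there (hole-map h)

fill-const : ∀ {A : Set} {n} (w : Vec A n) a → fill id (map just w) a ≡ w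
fill-const []      a = refl
fill-const (x ∷ w) a = cong (x ∷_) (fill-const w a)

fill-++ : ∀ {A : Set} {m n} (S : Template A m) (T : Template A n) a →
  fill id (S ++ T) a ≡ fill id S a ++ fill id T a
fill-++ S T a = Vecₚ.map-++ (maybe′ id a) S T

MonoLine : ∀ {A C : Set} {n} → (Vec A n → C) → Set
MonoLine {A} {C} {n} χ =
  Σ (Template A n) λ T → HasHole T × Σ C λ c → ∀ a → χ (fill id T a) ≡ c

-- The focused lines of the colour-focusing argument, with `zero` as the distinguished letter.
LineFocusedAt : ∀ {C : Set} {m n} → (Vec (Fin (suc m)) n → C) → Vec (Fin (suc m)) n → C → Set
LineFocusedAt {m = m} {n} χ w c =
  Σ (Template (Fin (suc m)) n) λ T →
    HasHole T × fill id T zero ≡ w × (∀ a → χ (fill id T (suc a)) ≡ c)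

ColourFocused : ∀ {C : Set} {m n} → ℕ → (Vec (Fin (suc m)) n → C) → Set
ColourFocused {C} {m} {n} j χ =
  Σ (Vec (Fin (suc m)) n) λ w → Σ (List C) λ cs →
    length cs ≡ j × AllPairs _≢_ cs × All (LineFocusedAt χ w) cs

-- All finite colour sets are covered at once because the induction on the alphabet applies the
-- smaller case to vectors of colours.
HalesJewett : ℕ → Set₁
HalesJewett m = ∀ {C : Set} → Finite C → Σ ℕ λ n → (χ : Vec (Fin m) n → C) → MonoLine χ

module Focusing {m : ℕ} (hj : HalesJewett (suc m)) {C : Set} (F : Finite C) where

  A : Set
  A = Fin (suc (suc m))

  Focuses : ℕ → ℕ → Set
  Focuses j n = (χ : Vec A n → C) → MonoLine χ ⊎ ColourFocused j χ

  module Step {n j : ℕ} (focuses : Focuses j n) where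

    words : Finite (Vec A n)
    words = Vec-finite (Fin-finite _) n

    tail-length : Σ ℕ λ k → (χ : Vec (Fin (suc m)) k → Vec C (card words)) → MonoLine χ
    tail-length = hj (Vec-finite F (card words))

    k : ℕ
    k = proj₁ tail-length

    module _ (χ : Vec A (n + k) → C) where

      -- Colours a tail by the colours it produces with every head. Its tails avoid the letter
      -- `zero`, so the smaller alphabet suffices.
      profile : Vec (Fin (suc m)) k → Vec C (card words)
      profile w = tabulate (λ i → χ (List.lookup (elems words) i ++ map suc w))

      tail-line : MonoLine profile
      tail-line = proj₂ tail-length profile

      T₀ : Template (Fin (suc m)) k
      T₀ = proj₁ tail-line

      T : Template A k
      T = map (Maybe.map suc) T₀

      T-hole : HasHole T
      T-hole = hole-map (proj₁ (proj₂ tail-line))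

      T-const : ∀ v a b → χ (v ++ fill id T (suc a)) ≡ χ (v ++ fill id T (suc b))
      T-const v a b = trans (at a) (sym (at b))
        where
        i = position words v
        colours = proj₁ (proj₂ (proj₂ tail-line))

        at : ∀ a → χ (v ++ fill id T (suc a)) ≡ lookup colours i
        at a = begin
          χ (v ++ fill id T (suc a))
            ≡⟨ cong₂ (λ v w → χ (v ++ w)) (lookup-position words v)
                 (trans (fill-map suc T₀ (suc a)) (sym (map-fill suc T₀ a))) ⟩
          χ (List.lookup (elems words) i ++ map suc (fill id T₀ a))
            ≡⟨ sym (Vecₚ.lookup∘tabulate _ i) ⟩
          lookup (profile (fill id T₀ a)) i
            ≡⟨ cong (λ cs → lookup cs i) (proj₂ (proj₂ (proj₂ tail-line)) a) ⟩
          lookup colours i ∎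
          where open ≡-Reasoning

      χ₁ : Vec A n → C
      -- By `T-const` any letter other than `zero` gives the same colouring.
      χ₁ v = χ (v ++ fill id T (suc zero))

      mono-extend : MonoLine χ₁ → MonoLine χ
      mono-extend (S , h , c , mono) =
        S ++ map just w , VAnyₚ.++⁺ˡ h , c ,
        λ a → trans (cong χ (trans (fill-++ S _ a) (cong (fill id S a ++_) (fill-const w a)))) (mono a)
        where w = fill id T (suc zero)

      -- Head and tail move together, so the line passes through the new focus; away from it,
      -- `T-const` reduces the colour to that under `χ₁`.
      focused-extend : ∀ {w c} → LineFocusedAt χ₁ w c → LineFocusedAt χ (w ++ fill id T zero) c
      focused-extend (S , h , at-zero , at-suc) =
        S ++ T , VAnyₚ.++⁺ˡ h ,
        trans (fill-++ S T zero) (cong (_++ fill id T zero) at-zero) ,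
        λ a → trans (cong χ (fill-++ S T (suc a))) (trans (T-const _ a zero) (at-suc a))

      -- Only the tail moves, which adds a line of colour `χ₁ w` with the same focus.
      focused-new : ∀ w → LineFocusedAt χ (w ++ fill id T zero) (χ₁ w)
      focused-new w =
        map just w ++ T , VAnyₚ.++⁺ʳ (map just w) T-hole , eq zero ,
        λ a → trans (cong χ (eq (suc a))) (T-const w a zero)
        where
        eq : ∀ a → fill id (map just w ++ T) a ≡ w ++ fill id T a
        eq a = trans (fill-++ (map just w) T a) (cong (_++ fill id T a) (fill-const w a))

      closed-line : ∀ {w} → LineFocusedAt χ₁ w (χ₁ w) → MonoLine χ₁
      closed-line {w} (S , h , at-zero , at-suc) =
        S , h , χ₁ w , λ { zero → cong χ₁ at-zero ; (suc a) → at-suc a }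

      step : MonoLine χ ⊎ ColourFocused (suc j) χ
      step with focuses χ₁
      ... | inj₁ mono = inj₁ (mono-extend mono)
      -- If the focus has the colour of a line focused at it, it completes that line; otherwise its
      -- colour is new and the family grows by one.
      ... | inj₂ (w , cs , len , distinct , focused) with Any.any? (Finite._≟_ F (χ₁ w)) cs
      ...   | yes w∈cs = inj₁ (mono-extend (closed-line (All.lookup focused w∈cs)))
      ...   | no  w∉cs = inj₂ (w ++ fill id T zero , χ₁ w ∷ cs , cong suc len ,
                               Allₚ.¬Any⇒All¬ cs w∉cs ∷ distinct ,
                               focused-new w ∷ All.map focused-extend focused)

  focusing : ∀ j → Σ ℕ (Focuses j)
  focusing zero    = 0 , λ χ → inj₂ ([] , [] , refl , [] , [])
  focusing (suc j) = let n , focuses = focusing j in n + _ , Step.step focuses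

-- Colour-focused lines cannot outnumber the colours, so asking for `suc (card F)` of them forces a
-- monochromatic line.
hales-jewett-suc : ∀ {m} → HalesJewett (suc m) → HalesJewett (suc (suc m))
hales-jewett-suc hj F = n , λ χ → mono χ (focuses χ)
  where
  open Focusing hj F
  n = proj₁ (focusing (suc (card F)))
  focuses = proj₂ (focusing (suc (card F)))

  mono : ∀ χ → MonoLine χ ⊎ ColourFocused (suc (card F)) χ → MonoLine χ
  mono χ (inj₁ line) = line
  mono χ (inj₂ (_ , cs , len , distinct , _)) =
    contradiction (subst (_≤ card F) len (distinct⇒length≤card F distinct)) ℕₚ.1+n≰n

hales-jewett : ∀ m → HalesJewett (suc m)
hales-jewett zero    F = 1 , λ χ → nothing ∷ [] , VAny.here refl , χ (zero ∷ []) , λ { zero → refl }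
hales-jewett (suc m) F = hales-jewett-suc (hales-jewett m) F

-- The empty alphabet occurs when no edge of the colour being treated joins the two chosen parts.
hales-jewett-or-empty : ∀ m → ¬ Fin m ⊎ HalesJewett m
hales-jewett-or-empty zero    = inj₁ λ ()
hales-jewett-or-empty (suc m) = inj₂ (hales-jewett m)

-- Ramsey's theorem for pairs

module _ {X : Set} where

  AllPairs-resp-⊆ : ∀ {R : Rel X 0ℓ} {xs ys} → xs ⊆ ys → AllPairs R ys → AllPairs R xs
  AllPairs-resp-⊆ []         []       = []
  AllPairs-resp-⊆ (_ ∷ʳ s)   (_ ∷ rs) = AllPairs-resp-⊆ s rs
  AllPairs-resp-⊆ (refl ∷ s) (r ∷ rs) = All-resp-⊆ s r ∷ AllPairs-resp-⊆ s rs

  length-filter-split : ∀ {P : Pred X 0ℓ} (P? : Decidable P) xs →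
    length (filter P? xs) + length (filter (¬? ∘ P?) xs) ≡ length xs
  length-filter-split P? []       = refl
  length-filter-split P? (x ∷ xs) with P? x
  ... | yes _ = cong suc (length-filter-split P? xs)
  ... | no  _ = trans (ℕₚ.+-suc _ _) (cong suc (length-filter-split P? xs))

module _ {X C : Set} (F : Finite C) (γ : X → C) (m : ℕ) where
  open Finite F using (_≟_)

  MonoSublist : List X → Set
  MonoSublist xs = Σ C λ c → Σ (List X) λ ys → ys ⊆ xs × All (λ y → γ y ≡ c) ys × m ≤ length ys

  -- Induction on the colours still possible: removing a class with fewer than `m` elements costs at
  -- most `m` elements and rules out one colour.
  pigeonhole-in : ∀ cs xs → All (λ x → γ x ∈ cs) xs → length cs * m < length xs → MonoSublist xs
  pigeonhole-in []       (_ ∷ _) (() ∷ _) _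
  pigeonhole-in (c ∷ cs) xs ∈cs big with m ≤? length (filter (λ x → γ x ≟ c) xs)
  ... | yes m≤ = c , filter (λ x → γ x ≟ c) xs , filter-⊆ _ xs , Allₚ.all-filter _ xs , m≤
  ... | no  m≰ =
    let d , ys , ys⊆ , mono , m≤ = pigeonhole-in cs rest rest∈cs rest-big
    in d , ys , ⊆-trans ys⊆ (filter-⊆ _ xs) , mono , m≤
    where
    chosen = filter (λ x → γ x ≟ c) xs
    rest   = filter (¬? ∘ λ x → γ x ≟ c) xs

    rest∈cs : All (λ x → γ x ∈ cs) rest
    rest∈cs = All.zipWith (λ { (here eq , ≢c) → contradiction eq ≢c ; (there p , _) → p })
      (All-resp-⊆ (filter-⊆ _ xs) ∈cs , Allₚ.all-filter _ xs)

    rest-big : length cs * m < length rest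
    rest-big = ℕₚ.+-cancelˡ-< m _ _ (begin-strict
      m + length cs * m           <⟨ big ⟩
      length xs                   ≡⟨ sym (length-filter-split (λ x → γ x ≟ c) xs) ⟩
      length chosen + length rest ≤⟨ ℕₚ.+-monoˡ-≤ _ (ℕₚ.≰⇒≥ m≰) ⟩
      m + length rest ∎)
      where open ℕₚ.≤-Reasoning

  pigeonhole : ∀ xs → card F * m < length xs → MonoSublist xs
  pigeonhole xs = pigeonhole-in (elems F) xs (All.universal (λ x → complete F (γ x)) xs)

prehomogeneous-bound : ℕ → ℕ → ℕ
prehomogeneous-bound r zero    = 0
-- One `suc` pays for the chosen element, the other makes the pigeonhole inequality strict.
prehomogeneous-bound r (suc m) = suc (suc (r * prehomogeneous-bound r m))

module _ {X C : Set} (F : Finite C) (R : Rel X 0ℓ) (d : X → X → C) where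

  PointsForward : Rel (X × C) 0ℓ
  PointsForward (x , c) (y , _) = R x y × d x y ≡ c

  -- The first element keeps only the later ones in a frequent colour, which becomes its label;
  -- recursion inside the kept elements makes each pair take the label of its earlier member.
  prehomogeneous : ∀ m xs → AllPairs R xs → prehomogeneous-bound (card F) m ≤ length xs →
    Σ (List (X × C)) λ ys →
      AllPairs PointsForward ys × List.map proj₁ ys ⊆ xs × length ys ≡ m
  prehomogeneous zero    xs       rs       _ = [] , [] , minimum xs , refl
  prehomogeneous (suc m) (x ∷ xs) (r ∷ rs) (s≤s big) =
    let c , zs , zs⊆ , mono , big′ = pigeonhole F (d x) (prehomogeneous-bound (card F) m) xs big
        ys , fwd , ys⊆ , len = prehomogeneous m zs (AllPairs-resp-⊆ zs⊆ rs) big′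
    in (x , c) ∷ ys ,
       Allₚ.map⁻ (All.zip (All-resp-⊆ (⊆-trans ys⊆ zs⊆) r , All-resp-⊆ ys⊆ mono)) ∷ fwd ,
       refl ∷ ⊆-trans ys⊆ zs⊆ , cong suc len


-- `d` is not assumed symmetric, so only increasing pairs are controlled.
Homogeneous : ∀ {C : Set} {p N} → (Fin p → Fin p → C) → C → Vec (Fin p) N → Set
Homogeneous d c g =
  ∀ {i j} → i Fin.< j → lookup g i ≢ lookup g j × d (lookup g i) (lookup g j) ≡ c

ramsey : ∀ {C} → Finite C → ∀ N →
  Σ ℕ λ p → (d : Fin p → Fin p → C) → Σ C λ c → Σ (Vec (Fin p) N) (Homogeneous d c)
ramsey {C} F N = p , λ d →
  let ys , fwd , _ , len = prehomogeneous F _≢_ d (suc (card F * N)) (List.allFin p)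
        (Uniqueₚ.allFin⁺ p) (ℕₚ.≤-reflexive (sym (Listₚ.length-tabulate id)))
      c , zs , zs⊆ , mono , N≤ = pigeonhole F proj₂ N ys (ℕₚ.≤-reflexive (sym len))
  in c , tabulate (chosen {zs} N≤) , homogeneous d (AllPairs-resp-⊆ zs⊆ fwd) mono N≤
  where
  -- Among `card F * N + 1` labelled elements some label occurs `N` times, and elements with equal
  -- labels form a homogeneous set.
  p = prehomogeneous-bound (card F) (suc (card F * N))

  chosen : ∀ {zs : List (Fin p × C)} → N ≤ length zs → Fin N → Fin p
  chosen {zs} N≤ i = proj₁ (List.lookup zs (Fin.inject≤ i N≤))

  homogeneous : ∀ d {c} {zs : List (Fin p × C)} → AllPairs (PointsForward F _≢_ d) zs →
    All (λ z → proj₂ z ≡ c) zs → (N≤ : N ≤ length zs) →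
    Homogeneous d c (tabulate (chosen {zs} N≤))
  homogeneous d {zs = zs} fwd mono N≤ {i} {j} i<j
    rewrite Vecₚ.lookup∘tabulate (chosen {zs} N≤) i
          | Vecₚ.lookup∘tabulate (chosen {zs} N≤) j =
    let x≢y , eq = AllPairs-lookup fwd
          (subst₂ _<_ (sym (Finₚ.toℕ-inject≤ i N≤)) (sym (Finₚ.toℕ-inject≤ j N≤)) i<j)
    in x≢y , trans eq (All.lookup mono (∈-lookup (Fin.inject≤ i N≤)))

-- The partite construction

Colour-finite : Finite Colour
Colour-finite .elems = red ∷ blue ∷ []
Colour-finite .complete red  = here refl
Colour-finite .complete blue = there (here refl)

_≟ᵐ_ : DecidableEquality (Maybe Colour)
_≟ᵐ_ = Maybeₚ.≡-dec (Finite._≟_ Colour-finite)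

guard : ∀ {P : Set} {X : Set} → Dec P → Maybe X → Maybe X
guard (yes _) m = m
guard (no _)  m = nothing

module _ {P X : Set} where

  guard-true : {d : Dec P} {m : Maybe X} → P → guard d m ≡ m
  guard-true {yes _} p = refl
  guard-true {no ¬p} p = contradiction p ¬p

  guard-just : {d : Dec P} {m : Maybe X} {x : X} → guard d m ≡ just x → P × m ≡ just x
  guard-just {yes p} eq = p , eq

guard-cong : ∀ {P Q X : Set} (d : Dec P) (e : Dec Q) {m m′ : Maybe X} →
  (P → Q) → (Q → P) → m ≡ m′ → guard d m ≡ guard e m′
guard-cong (yes _) (yes _) _ _ eq = eq
guard-cong (yes p) (no ¬q) f _ _  = contradiction (f p) ¬q
guard-cong (no ¬p) (yes q) _ g _  = contradiction (g q) ¬p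
guard-cong (no _)  (no _)  _ _ _  = refl

Clique : {V : Set} → (V → V → Maybe Colour) → Colour → ℕ → Set
Clique {V} col c K = Σ (Fin K → V) λ f → ∀ i j → i ≢ j → col (f i) (f j) ≡ just c

-- col u v ≡ nothing means that u and v are not adjacent.
record System (p : ℕ) : Set₁ where
  field
    V       : Set
    finite  : Finite V
    part    : V → Fin p
    col     : V → V → Maybe Colour
    col-sym : ∀ u v → col u v ≡ col v u
    partite : ∀ {u v c} → col u v ≡ just c → part u ≢ part v

-- Colours every ordered pair, adjacent or not, so pulling back takes no proofs of adjacency or
-- symmetry.
PairColouring : ∀ {p} → System p → Set
PairColouring P = System.V P → System.V P → Colour

record Hom {p} (P Q : System p) : Set where
  private
    module P = System P
    module Q = System Q
  field
    fun      : P.V → Q.V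
    fun-part : ∀ v → Q.part (fun v) ≡ P.part v
    fun-col  : ∀ {u v c} → P.col u v ≡ just c → Q.col (fun u) (fun v) ≡ just c
open Hom

id-hom : ∀ {p} {P : System p} → Hom P P
id-hom = record { fun = id ; fun-part = λ _ → refl ; fun-col = id }

_∘ʰ_ : ∀ {p} {P Q R : System p} → Hom Q R → Hom P Q → Hom P R
ψ ∘ʰ φ = record
  { fun      = fun ψ ∘ fun φ
  ; fun-part = λ v → trans (fun-part ψ (fun φ v)) (fun-part φ v)
  ; fun-col  = λ eq → fun-col ψ (fun-col φ eq)
  }

Uniform : ∀ {p} (P : System p) → PairColouring P → Fin p × Fin p × Colour → Colour → Set
Uniform P χ (a , b , t) c =
  ∀ u v → part u ≡ a → part v ≡ b → col u v ≡ just t → χ u v ≡ c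
  where open System P

pullback : ∀ {p} {P Q : System p} → Hom P Q → PairColouring Q → PairColouring P
pullback φ χ u v = χ (fun φ u) (fun φ v)

-- Homomorphisms respect parts and colours, so uniformity already obtained passes to every copy and
-- the triples can be treated one at a time.
uniform-pullback : ∀ {p} {P Q : System p} (φ : Hom P Q) {χ abt c} →
  Uniform Q χ abt c → Uniform P (pullback φ χ) abt c
uniform-pullback φ uni u v pu pv eq =
  uni _ _ (trans (fun-part φ _) pu) (trans (fun-part φ _) pv) (fun-col φ eq)

module Partite {p : ℕ} (size : Colour → ℕ) (3≤size : ∀ c → 3 ≤ size c) where

  Good : System p → Set
  Good P = ∀ c → ¬ Clique (System.col P) c (size c)

  module Amalgam (P : System p) (good : Good P) {a b : Fin p} (a≢b : a ≢ b) (t : Colour) where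
    open System P
    open Finite finite using () renaming (_≟_ to _≟ⱽ_)

    IsEdge : V × V → Set
    IsEdge (u , v) = part u ≡ a × part v ≡ b × col u v ≡ just t

    isEdge? : Decidable IsEdge
    isEdge? (u , v) = part u Finₚ.≟ a ×-dec part v Finₚ.≟ b ×-dec col u v ≟ᵐ just t

    edges : List (V × V)
    edges = filter isEdge? (elems (×-finite finite finite))

    -- The alphabet for Hales-Jewett: the edges of colour `t` from part `a` to part `b`.
    E : Set
    E = Fin (length edges)

    src tgt : E → V
    src e = proj₁ (List.lookup edges e)
    tgt e = proj₂ (List.lookup edges e)

    edge-col : ∀ e → col (src e) (tgt e) ≡ just t
    edge-col e = proj₂ (proj₂ (All.lookup
      (Allₚ.all-filter isEdge? (elems (×-finite finite finite))) (∈-lookup e)))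

    edge-index : ∀ {u v} → IsEdge (u , v) → Σ E λ e → src e ≡ u × tgt e ≡ v
    edge-index {u} {v} is = index uv∈ , cong proj₁ (sym (lookup-index uv∈)) , cong proj₂ (sym (lookup-index uv∈))
      where
      uv∈ : (u , v) ∈ edges
      uv∈ = ∈-filter⁺ isEdge? (complete (×-finite finite finite) (u , v)) is

    module _ {N : ℕ} where

      -- For two points of a line every coordinate is coloured t (a fixed edge) or like the pair filled in,
      -- so the first colour other than t, or t if there is none, is the colour of that pair.
      word-col : ∀ {n} → Vec V n → Vec V n → Maybe Colour
      word-col []       []       = just t
      word-col (x ∷ xs) (y ∷ ys) with col x y ≟ᵐ just t
      ... | yes _ = word-col xs ys
      ... | no  _ = col x y

      word-col-t : ∀ {n} (T : Template E n) {u v} → col u v ≡ just t →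
        word-col (fill src T u) (fill tgt T v) ≡ just t
      word-col-t []            eq = refl
      word-col-t (nothing ∷ T) {u} {v} eq with col u v ≟ᵐ just t
      ... | yes _ = word-col-t T eq
      ... | no ¬t = eq
      word-col-t (just e ∷ T)  eq with col (src e) (tgt e) ≟ᵐ just t
      ... | yes _ = word-col-t T eq
      ... | no ¬t = edge-col e

      -- At the first hole, `col u v` is returned if it differs from `t`; otherwise every coordinate
      -- has colour `t`. The equality also covers non-adjacent pairs, which allows cliques to be
      -- projected back to `P`.
      word-col-line : ∀ {n} (T : Template E n) i → lookup T i ≡ nothing → ∀ u v →
        word-col (fill src T u) (fill tgt T v) ≡ col u v
      word-col-line (nothing ∷ T) i hole u v with col u v ≟ᵐ just t
      ... | yes ≡t = trans (word-col-t T ≡t) (sym ≡t)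
      ... | no  _  = refl
      word-col-line (just e ∷ T) (suc i) hole u v with col (src e) (tgt e) ≟ᵐ just t
      ... | yes _ = word-col-line T i hole u v
      ... | no ¬t = contradiction (edge-col e) ¬t

      -- The distinguished coordinate is always a hole, whatever the template says there.
      Line : Set
      Line = Fin N × Template E N

      line-finite : Finite Line
      line-finite = ×-finite (Fin-finite N) (Vec-finite (Maybe-finite (Fin-finite _)) N)

      open Finite line-finite using () renaming (_≟_ to _≟ᴸ_)

      template : Line → Template E N
      template (i , T) = T [ i ]≔ nothing

      hole : ∀ l → lookup (template l) (proj₁ l) ≡ nothing
      hole (i , T) = Vecₚ.lookup∘update i T nothing

      embed : (E → V) → Line → V → Vec V N
      embed s l v = fill s (template l) v

      coord : Line → Vec V N → V
      coord (i , _) x = lookup x i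

      coord-embed : ∀ s l v → coord l (embed s l v) ≡ v
      coord-embed s l@(i , _) v = trans (Vecₚ.lookup-map i (maybe′ s v) (template l)) (cong (maybe′ s v) (hole l))

      -- Every line carries a copy of P; the copies share their vertices in the parts a and b only.
      data V′ : Set where
        a-word b-word : Vec V N → V′
        copy          : Line → V → V′

      V′-finite : Finite V′
      V′-finite .elems = List.map a-word words List.++
        List.map b-word words List.++ List.map (λ (l , v) → copy l v) copies
        where
        words  = elems (Vec-finite finite N)
        copies = elems (×-finite line-finite finite)
      V′-finite .complete (a-word x) = ∈-++⁺ˡ (∈-map⁺ a-word (complete (Vec-finite finite N) x))
      V′-finite .complete (b-word x) = ∈-++⁺ʳ (List.map a-word (elems (Vec-finite finite N)))
        (∈-++⁺ˡ (∈-map⁺ b-word (complete (Vec-finite finite N) x)))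
      V′-finite .complete (copy l v) = ∈-++⁺ʳ (List.map a-word (elems (Vec-finite finite N)))
        (∈-++⁺ʳ (List.map b-word (elems (Vec-finite finite N)))
          (∈-map⁺ (λ (l , v) → copy l v) (complete (×-finite line-finite finite) (l , v))))

      part′ : V′ → Fin p
      part′ (a-word _) = a
      part′ (b-word _) = b
      part′ (copy _ v) = part v

      -- The distinguished coordinate determines the only possible parameter, so membership is a
      -- decidable equation.
      OnLine : (E → V) → Line → Vec V N → Set
      OnLine s l x = x ≡ embed s l (coord l x)

      onLine? : ∀ s l x → Dec (OnLine s l x)
      onLine? s l x = Vecₚ.≡-dec _≟ⱽ_ x (embed s l (coord l x))

      -- A private vertex sees only words on its own line, each acting as its vertex at the
      -- distinguished coordinate. The guard on parts keeps the amalgam partite, as the letters of a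
      -- word need not lie in part `q`.
      spoke : Fin p → (E → V) → Vec V N → Line → V → Maybe Colour
      spoke q s x l v = guard (¬? (part v Finₚ.≟ q)) (guard (onLine? s l x) (col (coord l x) v))

      col′ : V′ → V′ → Maybe Colour
      col′ (a-word x) (a-word y) = nothing
      col′ (a-word x) (b-word y) = word-col x y
      col′ (a-word x) (copy l v) = spoke a src x l v
      col′ (b-word y) (a-word x) = word-col x y
      col′ (b-word x) (b-word y) = nothing
      col′ (b-word y) (copy l v) = spoke b tgt y l v
      col′ (copy l v) (a-word x) = spoke a src x l v
      col′ (copy l v) (b-word y) = spoke b tgt y l v
      col′ (copy l u) (copy m v) = guard (l ≟ᴸ m) (col u v)

      col′-sym : ∀ u v → col′ u v ≡ col′ v u
      col′-sym (a-word x) (a-word y) = refl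
      col′-sym (a-word x) (b-word y) = refl
      col′-sym (a-word x) (copy l v) = refl
      col′-sym (b-word y) (a-word x) = refl
      col′-sym (b-word x) (b-word y) = refl
      col′-sym (b-word y) (copy l v) = refl
      col′-sym (copy l v) (a-word x) = refl
      col′-sym (copy l v) (b-word y) = refl
      col′-sym (copy l u) (copy m v) = guard-cong (l ≟ᴸ m) (m ≟ᴸ l) sym sym (col-sym u v)

      spoke-just : ∀ {q s x l v c} → spoke q s x l v ≡ just c →
        part v ≢ q × OnLine s l x × col (coord l x) v ≡ just c
      spoke-just {q} {s} {x} {l} {v} eq =
        let ≢q , eq′ = guard-just {d = ¬? (part v Finₚ.≟ q)} eq
        in  ≢q , guard-just {d = onLine? s l x} eq′

      partite′ : ∀ {u v c} → col′ u v ≡ just c → part′ u ≢ part′ v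
      partite′ {a-word x} {b-word y} eq = a≢b
      partite′ {a-word x} {copy l v} eq = proj₁ (spoke-just {s = src} {x} eq) ∘ sym
      partite′ {b-word y} {a-word x} eq = a≢b ∘ sym
      partite′ {b-word y} {copy l v} eq = proj₁ (spoke-just {s = tgt} {y} eq) ∘ sym
      partite′ {copy l v} {a-word x} eq = proj₁ (spoke-just {s = src} {x} eq)
      partite′ {copy l v} {b-word y} eq = proj₁ (spoke-just {s = tgt} {y} eq)
      partite′ {copy l u} {copy m v} eq = partite (proj₂ (guard-just {d = l ≟ᴸ m} eq))

      amalgam : System p
      amalgam = record
        { V = V′ ; finite = V′-finite ; part = part′
        ; col = col′ ; col-sym = col′-sym ; partite = λ {u} {v} → partite′ {u} {v} }

      InCopy : Line → V′ → Set
      InCopy l (a-word x) = OnLine src l x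
      InCopy l (b-word y) = OnLine tgt l y
      InCopy l (copy m _) = m ≡ l

      project : Line → V′ → V
      project l (a-word x) = coord l x
      project l (b-word y) = coord l y
      project l (copy _ v) = v

      neighbour-in-copy : ∀ {l w c} q → col′ (copy l w) q ≡ just c → InCopy l q
      neighbour-in-copy (a-word x) eq = proj₁ (proj₂ (spoke-just {s = src} {x} eq))
      neighbour-in-copy (b-word y) eq = proj₁ (proj₂ (spoke-just {s = tgt} {y} eq))
      neighbour-in-copy {l} (copy m v) eq = sym (proj₁ (guard-just {d = l ≟ᴸ m} eq))

      word-col-project : ∀ {l x y c} → OnLine src l x → OnLine tgt l y →
        word-col x y ≡ just c → col (coord l x) (coord l y) ≡ just c
      word-col-project {l} {x} {y} onx ony eq = trans
        (sym (word-col-line (template l) (proj₁ l) (hole l) (coord l x) (coord l y)))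
        (trans (cong₂ word-col (sym onx) (sym ony)) eq)

      project-col : ∀ {l c} u v → InCopy l u → InCopy l v →
        col′ u v ≡ just c → col (project l u) (project l v) ≡ just c
      project-col (a-word x) (b-word y) onx ony eq = word-col-project onx ony eq
      project-col (b-word y) (a-word x) ony onx eq =
        trans (col-sym _ _) (word-col-project onx ony eq)
      project-col (a-word x) (copy l v) _ refl eq = proj₂ (proj₂ (spoke-just {s = src} {x} eq))
      project-col (b-word y) (copy l v) _ refl eq = proj₂ (proj₂ (spoke-just {s = tgt} {y} eq))
      project-col (copy l v) (a-word x) refl _ eq =
        trans (col-sym _ _) (proj₂ (proj₂ (spoke-just {s = src} {x} eq)))
      project-col (copy l v) (b-word y) refl _ eq =
        trans (col-sym _ _) (proj₂ (proj₂ (spoke-just {s = tgt} {y} eq)))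
      project-col (copy l u) (copy m v) _ _ eq = proj₂ (guard-just {d = l ≟ᴸ m} eq)

      data IsCopy : V′ → Set where
        is-copy : ∀ {l v} → IsCopy (copy l v)

      -- The words span a bipartite graph, so three pairwise adjacent vertices include one private
      -- to a copy.
      clique-has-copy : ∀ {K c} → 3 ≤ K → (f : Fin K → V′) →
        (∀ i j → i ≢ j → col′ (f i) (f j) ≡ just c) → Σ (Fin K) λ i → IsCopy (f i)
      clique-has-copy (s≤s (s≤s (s≤s _))) f cl
        with f zero in e₀ | f (suc zero) in e₁ | f (suc (suc zero)) in e₂
           | cl zero (suc zero) (λ ()) | cl zero (suc (suc zero)) (λ ()) | cl (suc zero) (suc (suc zero)) (λ ())
      ... | copy _ _ | _ | _ | _ | _ | _ = zero , subst IsCopy (sym e₀) is-copy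
      ... | a-word _ | copy _ _ | _ | _ | _ | _ = suc zero , subst IsCopy (sym e₁) is-copy
      ... | b-word _ | copy _ _ | _ | _ | _ | _ = suc zero , subst IsCopy (sym e₁) is-copy
      ... | a-word _ | b-word _ | copy _ _ | _ | _ | _ = suc (suc zero) , subst IsCopy (sym e₂) is-copy
      ... | b-word _ | a-word _ | copy _ _ | _ | _ | _ = suc (suc zero) , subst IsCopy (sym e₂) is-copy
      ... | a-word _ | a-word _ | _ | () | _ | _
      ... | b-word _ | b-word _ | _ | () | _ | _
      ... | a-word _ | b-word _ | a-word _ | _ | () | _
      ... | a-word _ | b-word _ | b-word _ | _ | _ | ()
      ... | b-word _ | a-word _ | a-word _ | _ | _ | ()
      ... | b-word _ | a-word _ | b-word _ | _ | () | _

      -- A clique with a vertex private to one copy of P lies in that copy.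
      amalgam-good : Good amalgam
      amalgam-good c (f , cl) with clique-has-copy (3≤size c) f cl
      ... | i , fi-copy with f i in fi
      amalgam-good c (f , cl) | i , is-copy | copy l w = good c (project l ∘ f , λ j k j≢k →
        project-col (f j) (f k) (in-copy j) (in-copy k) (cl j k j≢k))
        where
        in-copy : ∀ j → InCopy l (f j)
        in-copy j with i Finₚ.≟ j
        ... | yes refl = subst (InCopy l) (sym fi) refl
        ... | no i≢j   = neighbour-in-copy (f j) (subst (λ u → col′ u (f j) ≡ just c) fi (cl i j i≢j))

      place : Line → V → V′
      place l v with part v Finₚ.≟ a | part v Finₚ.≟ b
      ... | yes _ | _     = a-word (embed src l v)
      ... | no _  | yes _ = b-word (embed tgt l v)
      ... | no _  | no _  = copy l v

      spoke-embed : ∀ {q s l u v} → part v ≢ q → spoke q s (embed s l u) l v ≡ col u v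
      spoke-embed {q} {s} {l} {u} {v} ≢q =
        trans (guard-true {d = ¬? (part v Finₚ.≟ q)} ≢q)
        (trans (guard-true {d = onLine? s l (embed s l u)} (cong (embed s l) (sym (coord-embed s l u))))
               (cong (λ x → col x v) (coord-embed s l u)))

      place-part : ∀ l v → part′ (place l v) ≡ part v
      place-part l v with part v Finₚ.≟ a | part v Finₚ.≟ b
      ... | yes eq | _      = sym eq
      ... | no _   | yes eq = sym eq
      ... | no _   | no _   = refl

      place-col : ∀ l {u v c} → col u v ≡ just c → col′ (place l u) (place l v) ≡ just c
      place-col l {u} {v} eq
        with part u Finₚ.≟ a | part u Finₚ.≟ b | part v Finₚ.≟ a | part v Finₚ.≟ b
      ... | yes ua | _      | yes va | _      = contradiction (trans ua (sym va)) (partite eq)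
      ... | yes ua | _      | no _   | yes vb = trans (word-col-line (template l) (proj₁ l) (hole l) u v) eq
      ... | yes ua | _      | no ≢a  | no _   = trans (spoke-embed {s = src} {l} ≢a) eq
      ... | no _   | yes ub | yes va | _      =
        trans (word-col-line (template l) (proj₁ l) (hole l) v u) (trans (col-sym v u) eq)
      ... | no _   | yes ub | no _   | yes vb = contradiction (trans ub (sym vb)) (partite eq)
      ... | no _   | yes ub | no _   | no ≢b  = trans (spoke-embed {s = tgt} {l} ≢b) eq
      ... | no ≢a  | no _   | yes va | _      = trans (spoke-embed {s = src} {l} ≢a) (trans (col-sym v u) eq)
      ... | no _   | no ≢b  | no _   | yes vb = trans (spoke-embed {s = tgt} {l} ≢b) (trans (col-sym v u) eq)
      ... | no _   | no _   | no _   | no _   = trans (guard-true {d = l ≟ᴸ l} refl) eq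

      place-hom : Line → Hom P amalgam
      place-hom l = record { fun = place l ; fun-part = place-part l ; fun-col = place-col l }

      place-a : ∀ {l v} → part v ≡ a → place l v ≡ a-word (embed src l v)
      place-a {l} {v} va with part v Finₚ.≟ a
      ... | yes _ = refl
      ... | no ≢a = contradiction va ≢a

      place-b : ∀ {l v} → part v ≡ b → place l v ≡ b-word (embed tgt l v)
      place-b {l} {v} vb with part v Finₚ.≟ a | part v Finₚ.≟ b
      ... | yes va | _     = contradiction (trans (sym va) vb) a≢b
      ... | no _   | yes _ = refl
      ... | no _   | no ≢b = contradiction vb ≢b

      on-words : PairColouring amalgam → Vec E N → Colour
      on-words χ w = χ (a-word (map src w)) (b-word (map tgt w))

      -- In the copy on a monochromatic line, the `t`-edges from `a` to `b` correspond to the points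
      -- of that line, so they share its colour.
      place-uniform : (χ : PairColouring amalgam) → MonoLine (on-words χ) →
        Σ (Hom P amalgam) λ φ → Σ Colour (Uniform P (pullback φ χ) (a , b , t))
      place-uniform χ (T , has-hole , c , mono) = place-hom l , c , uniform
        where
        i = VAny.index has-hole
        -- The distinguished coordinate is an actual hole of `T`, so overwriting it changes nothing.
        l = i , T

        template-l : template l ≡ T
        template-l = trans (cong (T [ i ]≔_) (sym (VAnyₚ.lookup-index has-hole))) (Vecₚ.[]≔-lookup T i)

        embed-edge : ∀ s e → embed s l (s e) ≡ map s (fill id T e)
        embed-edge s e = trans (cong (λ T → fill s T (s e)) template-l) (sym (map-fill s T e))

        uniform : Uniform P (pullback (place-hom l) χ) (a , b , t) c
        uniform u v pu pv eq with edge-index (pu , pv , eq)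
        ... | e , refl , refl = trans
          (cong₂ χ (trans (place-a pu) (cong a-word (embed-edge src e)))
                   (trans (place-b pv) (cong b-word (embed-edge tgt e))))
          (mono e)

  Arrows : System p → System p → List (Fin p × Fin p × Colour) → Set
  Arrows P Q abts = (χ : PairColouring Q) → Σ (Hom P Q) λ φ →
    All (λ abt → Σ Colour (Uniform P (pullback φ χ) abt)) abts

  uniformise : ∀ P → Good P → ∀ abt → Σ (System p) λ Q → Good Q × Arrows P Q (abt ∷ [])
  uniformise P good (a , b , t) with a Finₚ.≟ b
  -- No edge lies within a part, so uniformity is vacuous and `red` is arbitrary.
  ... | yes refl = P , good , λ χ → id-hom ,
        (red , λ u v pu pv eq → contradiction (trans pu (sym pv)) (System.partite P eq)) ∷ []
  ... | no a≢b with hales-jewett-or-empty (length edges)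
    where open Amalgam P good a≢b t
  ...   | inj₁ empty = P , good , λ χ → id-hom ,
          (red , λ u v pu pv eq → contradiction (proj₁ (edge-index (pu , pv , eq))) empty) ∷ []
    where open Amalgam P good a≢b t
  ...   | inj₂ hj = amalgam , amalgam-good , λ χ →
          let φ , uniform = place-uniform χ (proj₂ (hj Colour-finite) (on-words χ)) in φ , uniform ∷ []
    where open Amalgam P good a≢b t

  -- Systems are built forwards but copies are found backwards: first a copy of `Q` uniform for the
  -- later triples, then inside it a copy of `P` uniform for the first.
  uniformise-all : ∀ P → Good P → ∀ abts → Σ (System p) λ Q → Good Q × Arrows P Q abts
  uniformise-all P good []           = P , good , λ χ → id-hom , []
  uniformise-all P good (abt ∷ abts) with uniformise P good abt
  ... | Q , Q-good , P→Q with uniformise-all Q Q-good abts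
  ...   | R , R-good , Q→R = R , R-good , arrow
    where
    arrow : Arrows P R (abt ∷ abts)
    arrow χ with Q→R χ
    ... | ψ , uniforms with P→Q (pullback ψ χ)
    ...   | φ , uniform ∷ [] =
      ψ ∘ʰ φ , uniform ∷ All.map (λ (c , uni) → c , uniform-pullback φ uni) uniforms

-- Colourings of complete graphs

size : ℕ → ℕ → Colour → ℕ
size k ℓ red  = k
size k ℓ blue = ℓ

clique? : ∀ {V} → Finite V → (col : V → V → Maybe Colour) → ∀ c K → Dec (Clique col c K)
clique? {V} F col c K = map′ (λ (g , cl) → lookup g , cl) tabulated
  (Finite.any? (Vec-finite F K) λ g → Finₚ.all? λ i → Finₚ.all? λ j →
    ¬? (i Finₚ.≟ j) →-dec (col (lookup g i) (lookup g j) ≟ᵐ just c))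
  where
  tabulated : Clique col c K →
    Σ (Vec V K) λ g → ∀ i j → i ≢ j → col (lookup g i) (lookup g j) ≡ just c
  tabulated (f , cl) = tabulate f , λ i j i≢j →
    trans (cong₂ col (Vecₚ.lookup∘tabulate f i) (Vecₚ.lookup∘tabulate f j)) (cl i j i≢j)

-- Only the entries above the diagonal are used.
Matrix : ℕ → Set
Matrix N = Vec (Vec Colour N) N

module _ {N : ℕ} (M : Matrix N) where

  matrix-col : Fin N → Fin N → Maybe Colour
  matrix-col u v with Finₚ.<-cmp u v
  ... | tri< _ _ _ = just (lookup (lookup M u) v)
  ... | tri≈ _ _ _ = nothing
  ... | tri> _ _ _ = just (lookup (lookup M v) u)

  matrix-col-sym : ∀ u v → matrix-col u v ≡ matrix-col v u
  matrix-col-sym u v with Finₚ.<-cmp u v | Finₚ.<-cmp v u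
  ... | tri< _ _ _   | tri> _ _ _   = refl
  ... | tri≈ _ _ _   | tri≈ _ _ _   = refl
  ... | tri> _ _ _   | tri< _ _ _   = refl
  ... | tri< u<v _ _ | tri< _ _ v≮u = contradiction u<v v≮u
  ... | tri< _ u≢v _ | tri≈ _ eq _  = contradiction (sym eq) u≢v
  ... | tri≈ _ eq _  | tri< _ v≢u _ = contradiction (sym eq) v≢u
  ... | tri≈ _ eq _  | tri> _ v≢u _ = contradiction (sym eq) v≢u
  ... | tri> _ u≢v _ | tri≈ _ eq _  = contradiction (sym eq) u≢v
  ... | tri> _ _ v<u | tri> v≮u _ _ = contradiction v<u v≮u

  matrix-col-total : ∀ {u v} → u ≢ v → ∃ λ c → matrix-col u v ≡ just c
  matrix-col-total {u} {v} u≢v with Finₚ.<-cmp u v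
  ... | tri< _ _ _  = _ , refl
  ... | tri≈ _ eq _ = contradiction eq u≢v
  ... | tri> _ _ _  = _ , refl

  matrix-col-irrefl : ∀ {u v c} → matrix-col u v ≡ just c → u ≢ v
  matrix-col-irrefl {u} {v} eq with Finₚ.<-cmp u v
  ... | tri< _ u≢v _ = u≢v
  ... | tri> _ u≢v _ = u≢v

Avoids : ∀ {N} → ℕ → ℕ → Matrix N → Set
Avoids k ℓ M = ∀ c → ¬ Clique (matrix-col M) c (size k ℓ c)

avoids? : ∀ {N} k ℓ → Decidable (Avoids {N} k ℓ)
avoids? {N} k ℓ M = map′ (λ { (r , b) red → r ; (r , b) blue → b }) (λ av → av red , av blue)
  (¬? (clique? (Fin-finite N) (matrix-col M) red k) ×-dec
   ¬? (clique? (Fin-finite N) (matrix-col M) blue ℓ))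

module _ {N : ℕ} (χ : Colouring (K N)) where

  entry : Fin N → Fin N → Colour
  entry u v with u Finₚ.≟ v
  ... | yes _   = red
  ... | no  u≢v = Colouring.col χ u v u≢v

  -- A colouring may depend on the proof of adjacency, so the proof used by `entry` is returned
  -- along with the colour.
  entry-col : ∀ {u v} → u ≢ v → Σ (u ≢ v) λ e → Colouring.col χ u v e ≡ entry u v
  entry-col {u} {v} u≢v with u Finₚ.≟ v
  ... | yes eq = contradiction eq u≢v
  ... | no  e  = e , refl

  matrix-of : Matrix N
  matrix-of = tabulate λ u → tabulate λ v → entry u v

  lookup-matrix-of : ∀ u v → lookup (lookup matrix-of u) v ≡ entry u v
  lookup-matrix-of u v = trans (cong (λ row → lookup row v) (Vecₚ.lookup∘tabulate _ u))
    (Vecₚ.lookup∘tabulate _ v)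

  matrix-of-col : ∀ {u v c} → matrix-col matrix-of u v ≡ just c →
    Σ (u ≢ v) λ e → Colouring.col χ u v e ≡ c
  matrix-of-col {u} {v} eq with Finₚ.<-cmp u v
  ... | tri< _ u≢v _ =
    let e , col≡ = entry-col u≢v
    in  e , trans col≡ (trans (sym (lookup-matrix-of u v)) (Maybeₚ.just-injective eq))
  ... | tri> _ u≢v _ =
    let e , col≡ = entry-col (u≢v ∘ sym)
    in  Graph.sym (K N) e , trans (Colouring.col-sym χ e)
          (trans col≡ (trans (sym (lookup-matrix-of v u)) (Maybeₚ.just-injective eq)))

clique⇒mono : ∀ (G : Graph) (χ : Colouring G) {c a} (f : Fin a → Fin (Graph.n G)) →
  (∀ i j → i ≢ j → Σ (Adj G (f i) (f j)) λ e → Colouring.col χ (f i) (f j) e ≡ c) →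
  MonoClique G χ c a
clique⇒mono G χ f cl = f , injective , cl
  where
  injective : ∀ i j → f i ≡ f j → i ≡ j
  injective i j eq with i Finₚ.≟ j
  ... | yes i≡j = i≡j
  ... | no  i≢j = contradiction (subst (Adj G (f i)) (sym eq) (proj₁ (cl i j i≢j))) (irr G)

-- The witness comes from a finite search: avoidance is decidable, and if no matrix avoids, every
-- colouring, read as a matrix, contains a forbidden clique.
avoiding-matrix : ∀ N k ℓ → ¬ (K N ⟶[ k , ℓ ]) → Σ (Matrix N) (Avoids k ℓ)
avoiding-matrix N k ℓ ¬arrow with Finite.any? (Vec-finite (Vec-finite Colour-finite N) N) (avoids? k ℓ)
... | yes found = found
... | no  none  = contradiction arrow ¬arrow
  where
  mono : ∀ χ {c a} → Clique (matrix-col (matrix-of χ)) c a → MonoClique (K N) χ c a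
  mono χ (f , cl) = clique⇒mono (K N) χ f λ i j i≢j → matrix-of-col χ (cl i j i≢j)

  arrow : K N ⟶[ k , ℓ ]
  arrow χ with clique? (Fin-finite N) (matrix-col (matrix-of χ)) red k
             | clique? (Fin-finite N) (matrix-col (matrix-of χ)) blue ℓ
  ... | yes cl | _      = inj₁ (mono χ cl)
  ... | no _   | yes cl = inj₂ (mono χ cl)
  ... | no ¬r  | no ¬b  = contradiction (matrix-of χ , λ { red → ¬r ; blue → ¬b }) none

restrict : ∀ {V c K K′} (col : V → V → Maybe Colour) → K ≤ K′ → Clique col c K′ → Clique col c K
restrict col K≤ (f , cl) = (λ i → f (Fin.inject≤ i K≤)) , λ i j i≢j →
  cl _ _ (i≢j ∘ Finₚ.inject≤-injective K≤ K≤ i j)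

-- Adding one vertex to a coloured complete graph

module Extension {N : ℕ} (M : Matrix N) (t : Colour) where

  ext-col : Fin (suc N) → Fin (suc N) → Colour
  ext-col zero    _       = t
  ext-col (suc u) zero    = t
  -- The default `t` is reached only on the diagonal.
  ext-col (suc u) (suc v) = fromMaybe t (matrix-col M u v)

  ext-col-sym : ∀ u v → ext-col u v ≡ ext-col v u
  ext-col-sym zero    zero    = refl
  ext-col-sym zero    (suc v) = refl
  ext-col-sym (suc u) zero    = refl
  ext-col-sym (suc u) (suc v) = cong (fromMaybe t) (matrix-col-sym M u v)

  extension : Colouring (K (suc N))
  extension = record { col = λ u v _ → ext-col u v ; col-sym = λ {u} {v} _ → ext-col-sym v u }

  ext-col-zero : ∀ u → ext-col u zero ≡ t
  ext-col-zero zero    = refl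
  ext-col-zero (suc u) = refl

  predecessor : ∀ {u : Fin (suc N)} → u ≢ zero → Σ (Fin N) λ v → u ≡ suc v
  predecessor {zero}  u≢0 = contradiction refl u≢0
  predecessor {suc v} _   = v , refl

  descend : ∀ {c a} (f : Fin a → Fin (suc N)) → (∀ i → f i ≢ zero) →
    (∀ i j → i ≢ j → f i ≢ f j × ext-col (f i) (f j) ≡ c) → Clique (matrix-col M) c a
  descend {c} f f≢0 cl = proj₁ ∘ pred , λ i j i≢j → edge i j (cl i j i≢j)
    where
    pred : ∀ i → Σ (Fin N) λ v → f i ≡ suc v
    pred i = predecessor (f≢0 i)

    edge : ∀ i j → f i ≢ f j × ext-col (f i) (f j) ≡ c →
      matrix-col M (proj₁ (pred i)) (proj₁ (pred j)) ≡ just c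
    edge i j (fi≢fj , eq) with f i | pred i | f j | pred j
    ... | _ | u , refl | _ | v , refl =
      let d , eq′ = matrix-col-total M (fi≢fj ∘ cong suc)
      in  trans eq′ (cong just (trans (sym (cong (fromMaybe t) eq′)) eq))

  -- By injectivity at most one index meets the new vertex; omitting it, or an arbitrary index if
  -- there is none, leaves a clique of `M`.
  same-colour : ∀ {a} → MonoClique (K (suc N)) extension t (suc a) → Clique (matrix-col M) t a
  same-colour {a} (f , inj , cl) = descend (f ∘ Fin.punchIn (proj₁ omit)) (proj₂ omit) λ i j i≢j →
      cl _ _ (i≢j ∘ Finₚ.punchIn-injective (proj₁ omit) i j)
    where
    omit : Σ (Fin (suc a)) λ i → ∀ j → f (Fin.punchIn i j) ≢ zero
    omit with Finₚ.any? (λ i → f i Finₚ.≟ zero)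
    ... | yes (i , fi≡0) = i , λ j eq → Finₚ.punchInᵢ≢i i j (inj _ _ (trans eq (sym fi≡0)))
    ... | no  none       = zero , λ j eq → none (_ , eq)

  -- All edges at the new vertex have colour `t`, so a clique of another colour with at least two
  -- vertices misses it.
  other-colour : ∀ {c a} → c ≢ t → 2 ≤ a →
    MonoClique (K (suc N)) extension c a → Clique (matrix-col M) c a
  other-colour {c} c≢t (s≤s (s≤s _)) (f , inj , cl) = descend f f≢0 cl
    where
    f≢0 : ∀ i → f i ≢ zero
    f≢0 i fi≡0 = c≢t (trans (sym (proj₂ (cl j i j≢i)))
      (trans (cong (ext-col (f j)) fi≡0) (ext-col-zero (f j))))
      where
      j = Fin.punchIn i zero
      j≢i = Finₚ.punchInᵢ≢i i zero

module _ {N k ℓ : ℕ} (arrow : K (suc N) ⟶[ suc k , suc ℓ ])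
  {M : Matrix N} (avoids : Avoids (suc k) (suc ℓ) M) where

  blue-clique : 1 ≤ k → Clique (matrix-col M) blue ℓ
  blue-clique 1≤k with arrow (Extension.extension M blue)
  ... | inj₁ r = contradiction (Extension.other-colour M blue (λ ()) (s≤s 1≤k) r) (avoids red)
  ... | inj₂ b = Extension.same-colour M blue b

  red-clique : 1 ≤ ℓ → Clique (matrix-col M) red k
  red-clique 1≤ℓ with arrow (Extension.extension M red)
  ... | inj₁ r = Extension.same-colour M red r
  ... | inj₂ b = contradiction (Extension.other-colour M red (λ ()) (s≤s 1≤ℓ) b) (avoids blue)

-- Passing from systems to graphs

module Underlying {p : ℕ} (P : System p) where
  open System P

  vertex : Fin (card finite) → V
  vertex = List.lookup (elems finite)

  Is-just-sym : ∀ {u v} → Is-just (col u v) → Is-just (col v u)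
  Is-just-sym {u} {v} = subst Is-just (col-sym u v)

  graph : Graph
  graph = record
    { n   = card finite
    ; Adj = λ i j → Is-just (col (vertex i) (vertex j))
    ; sym = Is-just-sym
    ; irr = λ {i} e → partite (witness e) refl
    }
    where
    witness : ∀ {m : Maybe Colour} (e : Is-just m) → m ≡ just (to-witness e)
    witness (just _) = refl

  to-witness-subst : ∀ {m m′ : Maybe Colour} (eq : m ≡ m′) e → to-witness (subst Is-just eq e) ≡ to-witness e
  to-witness-subst refl e = refl

  own-colouring : Colouring graph
  own-colouring = record
    { col     = λ i j e → to-witness e
    ; col-sym = λ {i} {j} e → to-witness-subst (col-sym (vertex i) (vertex j)) e
    }

  own-clique : ∀ {c a} → MonoClique graph own-colouring c a → Clique col c a
  own-clique (f , _ , cl) = vertex ∘ f , λ i j i≢j → let e , eq = cl i j i≢j in witness e eq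
    where
    witness : ∀ {m : Maybe Colour} {c} (e : Is-just m) → to-witness e ≡ c → m ≡ just c
    witness (just _) refl = refl

  module _ (χ : Colouring graph) where

    read : (m : Maybe Colour) → (Is-just m → Colour) → Colour
    read nothing  _ = red
    read (just _) k = k (just tt)

    -- `Is-just m` has at most one proof, so an edge colour cannot depend on the proof of adjacency.
    read-edge : ∀ {m} k (e : Is-just m) → read m k ≡ k e
    read-edge k (just tt) = refl

    ix : V → Fin (card finite)
    ix = position finite

    -- Coloured red off the edges.
    total : PairColouring P
    total u v = read (col (vertex (ix u)) (vertex (ix v))) (Colouring.col χ (ix u) (ix v))

    edge : ∀ {u v c} → col u v ≡ just c → Adj graph (ix u) (ix v)
    edge {u} {v} eq = subst₂ (λ u v → Is-just (col u v)) (lookup-position finite u) (lookup-position finite v)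
      (subst Is-just (sym eq) (just tt))

    total-edge : ∀ {u v} (e : Adj graph (ix u) (ix v)) → Colouring.col χ (ix u) (ix v) e ≡ total u v
    total-edge e = sym (read-edge (Colouring.col χ _ _) e)

    -- Either orientation of a pair suffices by the symmetry of `χ`; the Ramsey step controls only
    -- increasing pairs.
    total-mono : ∀ {c a} (f : Fin a → V) →
      (∀ i j → i ≢ j → (∃ λ d → col (f i) (f j) ≡ just d) ×
                       (total (f i) (f j) ≡ c ⊎ total (f j) (f i) ≡ c)) →
      MonoClique graph χ c a
    total-mono {c} f cl = clique⇒mono graph χ (ix ∘ f) λ i j i≢j → mono (cl i j i≢j)
      where
      mono : ∀ {u v} → (∃ λ d → col u v ≡ just d) × (total u v ≡ c ⊎ total v u ≡ c) →
        Σ (Adj graph (ix u) (ix v)) λ e → Colouring.col χ (ix u) (ix v) e ≡ c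
      mono ((_ , eq) , inj₁ uv) = edge eq , trans (total-edge (edge eq)) uv
      mono {u} {v} ((_ , eq) , inj₂ vu) = edge eq ,
        trans (sym (Colouring.col-sym χ (edge eq))) (trans (total-edge (Graph.sym graph (edge eq))) vu)

-- The initial system of disjoint copies

module Copies {N : ℕ} (p : ℕ) (M : Matrix N) where

  -- There is one copy of `M` for each assignment `g` of its vertices to the `p` parts. `col₀` drops
  -- edges within a part, so a copy with injective `g` keeps all its edges.
  V₀ : Set
  V₀ = Vec (Fin p) N × Fin N

  part₀ : V₀ → Fin p
  part₀ (g , i) = lookup g i

  words : Finite (Vec (Fin p) N)
  words = Vec-finite (Fin-finite p) N

  col₀ : V₀ → V₀ → Maybe Colour
  col₀ (g , i) (h , j) = guard (Finite._≟_ words g h)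
    (guard (¬? (lookup g i Finₚ.≟ lookup h j)) (matrix-col M i j))

  col₀-just : ∀ {g h i j c} → col₀ (g , i) (h , j) ≡ just c →
    lookup g i ≢ lookup h j × matrix-col M i j ≡ just c
  col₀-just {g} {h} {i} {j} eq = guard-just {d = ¬? (lookup g i Finₚ.≟ lookup h j)}
    (proj₂ (guard-just {d = Finite._≟_ words g h} eq))

  col₀-edge : ∀ {g i j} → lookup g i ≢ lookup g j → col₀ (g , i) (g , j) ≡ matrix-col M i j
  col₀-edge {g} {i} {j} ≢ = trans (guard-true {d = Finite._≟_ words g g} refl)
    (guard-true {d = ¬? (lookup g i Finₚ.≟ lookup g j)} ≢)

  copies : System p
  copies = record
    { V       = V₀
    ; finite  = ×-finite words (Fin-finite N)
    ; part    = part₀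
    ; col     = col₀
    ; col-sym = λ (g , i) (h , j) → guard-cong (Finite._≟_ words g h) (Finite._≟_ words h g) sym sym
        (guard-cong (¬? (lookup g i Finₚ.≟ lookup h j)) (¬? (lookup h j Finₚ.≟ lookup g i))
          (λ ≢ → ≢ ∘ sym) (λ ≢ → ≢ ∘ sym) (matrix-col-sym M i j))
    ; partite = λ eq → proj₁ (col₀-just eq)
    }

  copies-good : ∀ {k ℓ} → Avoids k ℓ M → ∀ c → ¬ Clique col₀ c (size k ℓ c)
  copies-good avoids c (f , cl) = avoids c (proj₂ ∘ f , λ i j i≢j → proj₂ (col₀-just (cl i j i≢j)))

-- Recolouring a homogeneous copy

module Construction {N k ℓ p : ℕ} (M : Matrix N)
  (Q : System p) (Q-good : ∀ c → ¬ Clique (System.col Q) c (size k ℓ c))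
  (arrows : (χ : PairColouring Q) → Σ (Hom (Copies.copies p M) Q) λ φ →
    ∀ abt → Σ Colour (Uniform (Copies.copies p M) (pullback φ χ) abt))
  (homogeneous-set : (d : Fin p → Fin p → Colour × Colour) →
    Σ (Colour × Colour) λ γ → Σ (Vec (Fin p) N) (Homogeneous d γ))
  where

  open Copies p M
  open Underlying Q

  graph-avoids : ¬ (graph ⟶[ k , ℓ ])
  graph-avoids arrow with arrow own-colouring
  ... | inj₁ r = Q-good red (own-clique r)
  ... | inj₂ b = Q-good blue (own-clique b)

  select : Colour × Colour → Colour → Colour
  select (r , b) red  = r
  select (r , b) blue = b

  module _ (χ : Colouring graph) where

    φ : Hom copies Q
    φ = proj₁ (arrows (total χ))

    uniform : ∀ abt → Σ Colour (Uniform copies (pullback φ (total χ)) abt)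
    uniform = proj₂ (arrows (total χ))

    -- The pair of colours encodes the map `γ` by its values at red and blue, so Ramsey's theorem is
    -- applied with four colours.
    d : Fin p → Fin p → Colour × Colour
    d a b = proj₁ (uniform (a , b , red)) , proj₁ (uniform (a , b , blue))

    d-uniform : ∀ a b t → Uniform copies (pullback φ (total χ)) (a , b , t) (select (d a b) t)
    d-uniform a b red  = proj₂ (uniform (a , b , red))
    d-uniform a b blue = proj₂ (uniform (a , b , blue))

    -- The copy indexed by the homogeneous `g` occupies distinct parts, hence keeps all edges, and
    -- `χ` recolours each of them by the same `γ`.
    recolouring : Σ (Colour × Colour) λ γ → ∀ {c a} (h : Fin a → Fin N) →
      (∀ i j → i ≢ j → ∃ λ t → matrix-col M (h i) (h j) ≡ just t × select γ t ≡ c) →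
      MonoClique graph χ c a
    recolouring with homogeneous-set d
    ... | γ , g , homogeneous = γ , λ h cl → total-mono χ (λ i → Hom.fun φ (g , h i))
        λ i j i≢j → edge-colour (h i) (h j) (cl i j i≢j)
      where
      increasing : ∀ {i j t} → i Fin.< j → matrix-col M i j ≡ just t →
        System.col Q (Hom.fun φ (g , i)) (Hom.fun φ (g , j)) ≡ just t ×
        total χ (Hom.fun φ (g , i)) (Hom.fun φ (g , j)) ≡ select γ t
      increasing {i} {j} {t} i<j eq =
        let gi≢gj , dγ = homogeneous i<j
            eq₀ = trans (col₀-edge {g} gi≢gj) eq
        in Hom.fun-col φ eq₀ ,
           trans (d-uniform _ _ t (g , i) (g , j) refl refl eq₀) (cong (λ γ → select γ t) dγ)

      edge-colour : ∀ {c} i j → (∃ λ t → matrix-col M i j ≡ just t × select γ t ≡ c) →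
        (∃ λ t → System.col Q (Hom.fun φ (g , i)) (Hom.fun φ (g , j)) ≡ just t) ×
        (total χ (Hom.fun φ (g , i)) (Hom.fun φ (g , j)) ≡ c ⊎
         total χ (Hom.fun φ (g , j)) (Hom.fun φ (g , i)) ≡ c)
      edge-colour i j (t , eq , γt) = case Finₚ.<-cmp i j of λ where
        (tri< i<j _ _) → let e , tot = increasing i<j eq in (t , e) , inj₁ (trans tot γt)
        (tri≈ _ i≡j _) → contradiction i≡j (matrix-col-irrefl M eq)
        (tri> _ _ j<i) → let e , tot = increasing j<i (trans (matrix-col-sym M j i) eq)
          in (t , trans (System.col-sym Q _ _) e) , inj₂ (trans tot γt)

  graph-arrows : ∀ {m s} → Clique (matrix-col M) red m → Clique (matrix-col M) blue m →
    s ≤ N → graph ⟶[ s , m ]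
  graph-arrows (rf , rcl) (bf , bcl) s≤N χ with recolouring χ
  ... | (_    , blue) , mono = inj₂ (mono bf λ i j i≢j → blue , bcl i j i≢j , refl)
  ... | (blue , red)  , mono = inj₂ (mono rf λ i j i≢j → red , rcl i j i≢j , refl)
  ... | (red  , red)  , mono = inj₁ (mono (λ i → Fin.inject≤ i s≤N) λ i j i≢j →
      let t , eq = matrix-col-total M (i≢j ∘ Finₚ.inject≤-injective s≤N s≤N i j)
      in  t , eq , all-red t)
    where
    all-red : ∀ t → select (red , red) t ≡ red
    all-red red  = refl
    all-red blue = refl

-- Makes the Ramsey number positive, so that `r ∸ 1` is a true predecessor.
¬K₀-arrows : ∀ {k ℓ} → ¬ (K 0 ⟶[ suc k , suc ℓ ])
¬K₀-arrows arrow with arrow (record { col = λ () ; col-sym = λ { {()} } })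
... | inj₁ (f , _) = Finₚ.¬Fin0 (f zero)
... | inj₂ (f , _) = Finₚ.¬Fin0 (f zero)

ramsey-graph : ∀ {k ℓ m N} → (∀ c → 3 ≤ size k ℓ c) → (M : Matrix N) → Avoids k ℓ M →
  Clique (matrix-col M) red m → Clique (matrix-col M) blue m →
  Σ Graph λ G → ¬ (G ⟶[ k , ℓ ]) × (∀ s → s ≤ N → G ⟶[ s , m ])
ramsey-graph {k} {ℓ} {N = N} 3≤size M avoids r b
  -- The number of parts is fixed first; the partite construction then preserves it.
  with ramsey (×-finite Colour-finite Colour-finite) N
... | p , homogeneous-set
  with Partite.uniformise-all (size k ℓ) 3≤size (Copies.copies p M) (Copies.copies-good p M avoids)
         (elems (×-finite (Fin-finite p) (×-finite (Fin-finite p) Colour-finite)))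
... | Q , Q-good , arrows = Underlying.graph Q , graph-avoids , λ s → graph-arrows r b
  where
  triples : Finite (Fin p × Fin p × Colour)
  triples = ×-finite (Fin-finite p) (×-finite (Fin-finite p) Colour-finite)

  arrows′ : (χ : PairColouring Q) → Σ (Hom (Copies.copies p M) Q) λ φ →
    ∀ abt → Σ Colour (Uniform (Copies.copies p M) (pullback φ χ) abt)
  arrows′ χ = let φ , uniform = arrows χ in φ , λ abt → All.lookup uniform (complete triples abt)

  open Construction {k = k} {ℓ} M Q Q-good arrows′ homogeneous-set

theorem5p1 : (k ℓ : ℕ) → 3 ≤ ℓ → ℓ ≤ k → (r : ℕ) → IsRamseyNumber k ℓ r →
    Σ Graph λ G → ¬ (G ⟶[ k , ℓ ]) × ((s : ℕ) → s ≤ r ∸ 1 → G ⟶[ s , ℓ ∸ 1 ])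
theorem5p1 (suc k) (suc ℓ) 3≤ℓ ℓ≤k zero    (arrow , _) = contradiction arrow ¬K₀-arrows
theorem5p1 (suc k) (suc ℓ) 3≤ℓ (s≤s ℓ≤k) (suc N) (arrow , least)
  with avoiding-matrix N (suc k) (suc ℓ) (least N ℕₚ.≤-refl)
... | M , avoids = ramsey-graph 3≤size M avoids
    -- Here `k` and `ℓ` are one less than in the statement. The red clique has `k` vertices and is
    -- cut down to `ℓ`, the size of the blue one.
    (restrict (matrix-col M) ℓ≤k (red-clique arrow avoids 1≤ℓ))
    (blue-clique arrow avoids (ℕₚ.≤-trans 1≤ℓ ℓ≤k))
  where
  1≤ℓ : 1 ≤ ℓ
  1≤ℓ = s≤s⁻¹ (ℕₚ.≤-trans (s≤s (s≤s z≤n)) 3≤ℓ)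

  3≤size : ∀ c → 3 ≤ size (suc k) (suc ℓ) c
  3≤size red  = ℕₚ.≤-trans 3≤ℓ (s≤s ℓ≤k)
  3≤size blue = 3≤ℓ
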